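{- Let $\mathcal P$ be an abstract cell complex satisfying axioms (A1)–(A3), let $d\ge1$, and let $Z$ be a simple $d$-cycle of $\mathcal P$ with compatible support. Then the facet graph $G_d(Z)$ is $(d+1)$-connected. More strongly, for any $r$ $d$-cells and $q$ $(d-1)$-cells with $r+q\le d$, the graph obtained from $G_d(Z)$ by deleting the vertices of the $r$ chosen $d$-cells and deleting every edge whose two endpoints both contain one of the $q$ chosen $(d-1)$-cells, is connected.
   Context: Fix a field $\mathbb F$. An abstract cell complex is a graded poset $\mathcal P$, whose elements are called open cells and whose rank is called dimension; it has a unique minimal element $\emptyset$ of dimension $-1$, and its elements of dimension $0$ are identified with singletons of $[n]$. For an open cell $C^o$, the closed cell $K(C^o)$ is the set of elements of $\mathcal P$ that are $\le C^o$. A $d$-chain is a formal $\mathbb F$-combination of open $d$-cells; its support is the set of cells with nonzero coefficient. Axioms: (A1) the restriction of $\mathcal P$ to any $K(C^o)$ is a lattice; (A2) for each $d\ge0$ there is a linear boundary operator $\partial_d$ from $d$-chains to $(d-1)$-chains, with $\partial_d C^o$ supported on the $(d-1)$-dimensional elements of $K(C^o)$, $\partial_0\{i\}=\emptyset$, and $\partial_{d-1}\partial_d=0$; (A3) for every open $d$-cell $C^o$, every $(d-1)$-cycle supported in $K(C^o)$ is a scalar multiple of $\partial C^o$. A $d$-cycle is a $d$-chain $Z$ with $\partial Z=0$; it is simple if $Z\ne0$ and every $d$-cycle supported in $\mathrm{Supp}(Z)$ is a scalar multiple of $Z$. A set of cells is compatible if some closed cell of $\mathcal P$ contains all of them. The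 facet graph $G_d(Z)$ has vertex set $\mathrm{Supp}(Z)$, two $d$-cells adjacent iff some $(d-1)$-cell lies below both. A graph is $k$-connected if deleting any set of fewer than $k$ of its vertices leaves a nonempty connected graph.
   Formalization: Axiom (A2) is taken to include that the boundary of every open cell is nonzero (otherwise the poset ∅ < v < e with ∂e = 0 is a counterexample); equality in the field and the order and equality of cells are assumed decidable, which is automatic classically. -}

module Defs where

open import Level using (Level; _⊔_) renaming (suc to lsuc)
open import Algebra.Bundles using (CommutativeRing)
open import Algebra.Module.Bundles.Raw using (RawLeftModule)
open import Algebra.Module.Morphism.Structures using (module LeftModuleMorphisms)
import Algebra.Properties.Ring as RingProperties
open import Data.Bool.Base using (if_then_else_)
open import Data.Fin.Base using (Fin)
open import Data.List.Base using (List; []; _∷_; _++_; length)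
open import Data.List.Membership.Propositional using (_∈_; _∉_)
open import Data.List.Membership.Propositional.Properties using (∈-++⁺ˡ; ∈-++⁺ʳ)
open import Data.List.Relation.Unary.All using (All)
open import Data.List.Relation.Unary.Any using (Any; here)
import Data.Nat.Base as ℕ
open ℕ using (ℕ; zero; suc)
open import Data.Nat.Properties using (≡-irrelevant)
open import Data.Product.Base using (Σ-syntax; ∃; ∃-syntax; _×_; _,_; proj₁; proj₂)
open import Data.Unit.Polymorphic using (⊤)
open import Function.Base using (_on_)
open import Function.Bundles using (_↔_)
open import Relation.Binary.Construct.Closure.ReflexiveTransitive using (Star)
import Relation.Binary.Construct.NonStrictToStrict as ToStrict
open import Relation.Binary.Core using (Rel)
open import Relation.Binary.Definitions using (Decidable)
open import Relation.Binary.Lattice.Structures using (IsLattice)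
open import Relation.Binary.PropositionalEquality using (_≡_; _≢_; refl)
open import Relation.Binary.Structures using (IsDecPartialOrder)
open import Relation.Nullary.Decidable.Core using (does; yes; no)
open import Relation.Nullary.Negation.Core using (¬_; contradiction)
open import Relation.Unary using (Pred)

record Field (a ℓ : Level) : Set (lsuc (a ⊔ ℓ)) where
  field
    commutativeRing : CommutativeRing a ℓ
  open CommutativeRing commutativeRing public
  field
    _≈?_    : Decidable _≈_
    1≉0     : ¬ (1# ≈ 0#)
    inverse : ∀ x → ¬ (x ≈ 0#) → ∃[ y ] x * y ≈ 1#

------------------------------------------------------------------------
-- Graphs

-- The vertex set is a subset of an ambient type A; only pairs of
-- vertices related by Adj count as edges.
record Graph {a : Level} (A : Set a) (v e : Level) : Set (a ⊔ lsuc (v ⊔ e)) where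
  field
    Vertex : Pred A v
    Adj    : Rel A e

  Edge : Rel A (v ⊔ e)
  Edge x y = Vertex x × Vertex y × Adj x y

open Graph public using (Vertex; Adj; Edge)

module _ {a v e : Level} {A : Set a} where

  -- The empty graph is not connected.
  Connected : Graph A v e → Set (a ⊔ v ⊔ e)
  Connected G = ∃ (Vertex G)
              × (∀ x y → Vertex G x → Vertex G y → Star (Edge G) x y)

  deleteVertices : List A → Graph A v e → Graph A (a ⊔ v) e
  deleteVertices S G = record
    { Vertex = λ x → Vertex G x × x ∉ S
    ; Adj    = Adj G
    }

  deleteEdges : {p : Level} → Rel A p → Graph A v e → Graph A v (e ⊔ p)
  deleteEdges D G = record
    { Vertex = Vertex G
    ; Adj    = λ x y → Adj G x y × ¬ D x y
    }

-- A set of fewer than k vertices is given by a list of length < k;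
-- repetitions are harmless.
VertexConnected : {a v e : Level} {A : Set a} → ℕ → Graph A v e → Set (a ⊔ v ⊔ e)
VertexConnected {A = A} k G =
  (S : List A) → All (Vertex G) S → length S ℕ.< k → Connected (deleteVertices S G)

------------------------------------------------------------------------
-- Graded posets

-- The rank is normalised to start at 0 rather than −1, so that a cell
-- of dimension d has rank d + 1.
record GradedPoset (c ℓ : Level) : Set (lsuc (c ⊔ ℓ)) where
  infix 4 _≤_
  field
    Cell              : Set c
    _≤_               : Rel Cell ℓ
    isDecPartialOrder : IsDecPartialOrder _≡_ _≤_
    rank              : Cell → ℕ

  open IsDecPartialOrder isDecPartialOrder public using (_≟_; _≤?_)
  open ToStrict _≡_ _≤_ public using (_<_)

  _⋖_ : Rel Cell (c ⊔ ℓ)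
  x ⋖ y = x < y × (∀ z → ¬ (x < z × z < y))

  Minimal : Pred Cell (c ⊔ ℓ)
  Minimal x = ∀ y → y ≤ x → y ≡ x

  field
    rank-mono  : ∀ {x y} → x < y → rank x ℕ.< rank y
    rank-cover : ∀ {x y} → x ⋖ y → rank y ≡ suc (rank x)

  CellOfRank : ℕ → Set c
  CellOfRank k = Σ[ x ∈ Cell ] rank x ≡ k

  _⊑_ : ∀ {j k} → CellOfRank j → CellOfRank k → Set ℓ
  x ⊑ y = proj₁ x ≤ proj₁ y

  Closed : Cell → Set (c ⊔ ℓ)
  Closed C = Σ[ x ∈ Cell ] x ≤ C

  ClosedIsLattice : Cell → Set (c ⊔ ℓ)
  ClosedIsLattice C =
    Σ[ join ∈ (Closed C → Closed C → Closed C) ]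
    Σ[ meet ∈ (Closed C → Closed C → Closed C) ]
      IsLattice (_≡_ on proj₁) (_≤_ on proj₁) join meet

------------------------------------------------------------------------
-- Chains

module Chains {a ℓ c ℓ′ : Level} (F : Field a ℓ) (P : GradedPoset c ℓ′) where
  open Field F renaming (Carrier to Scalar; refl to ≈-refl; trans to ≈-trans)
  open GradedPoset P using (CellOfRank; _≟_)
  open RingProperties ring using (-0#≈0#)

  -- Chain k consists of the chains of dimension k − 1.
  record Chain (k : ℕ) : Set (a ⊔ ℓ ⊔ c) where
    field
      coeff  : CellOfRank k → Scalar
      cells  : List (CellOfRank k)
      finite : ∀ x → ¬ (coeff x ≈ 0#) → x ∈ cells

  open Chain public

  Supp : ∀ {k} → Chain k → Pred (CellOfRank k) ℓ
  Supp Z x = ¬ (coeff Z x ≈ 0#)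

  infix 4 _≈ᶜ_
  _≈ᶜ_ : ∀ {k} → Rel (Chain k) (ℓ ⊔ c)
  Y ≈ᶜ Z = ∀ x → coeff Y x ≈ coeff Z x

  0ᶜ : ∀ {k} → Chain k
  0ᶜ = record
    { coeff  = λ _ → 0#
    ; cells  = []
    ; finite = λ _ 0≉0 → contradiction ≈-refl 0≉0
    }

  infixl 6 _+ᶜ_
  _+ᶜ_ : ∀ {k} → Chain k → Chain k → Chain k
  _+ᶜ_ {k} Y Z = record
    { coeff  = λ x → coeff Y x + coeff Z x
    ; cells  = cells Y ++ cells Z
    ; finite = fin
    }
    where
    fin : ∀ x → ¬ (coeff Y x + coeff Z x ≈ 0#) → x ∈ cells Y ++ cells Z
    fin x s≉0 with coeff Y x ≈? 0#
    ... | no  y≉0 = ∈-++⁺ˡ (finite Y x y≉0)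
    ... | yes y≈0 = ∈-++⁺ʳ (cells Y) (finite Z x λ z≈0 →
                      s≉0 (≈-trans (+-cong y≈0 z≈0) (+-identityˡ 0#)))

  infixr 7 _·_
  _·_ : ∀ {k} → Scalar → Chain k → Chain k
  s · Z = record
    { coeff  = λ x → s * coeff Z x
    ; cells  = cells Z
    ; finite = λ x sz≉0 → finite Z x λ z≈0 →
                 sz≉0 (≈-trans (*-congˡ z≈0) (zeroʳ s))
    }

  -ᶜ_ : ∀ {k} → Chain k → Chain k
  -ᶜ Z = record
    { coeff  = λ x → - coeff Z x
    ; cells  = cells Z
    ; finite = λ x -z≉0 → finite Z x λ z≈0 →
                 -z≉0 (≈-trans (-‿cong z≈0) -0#≈0#)
    }

  ⟦_⟧ : ∀ {k} → CellOfRank k → Chain k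
  ⟦_⟧ {k} C@(C₀ , C₀-rank) = record
    { coeff  = coeff′
    ; cells  = C ∷ []
    ; finite = fin
    }
    where
    coeff′ : CellOfRank k → Scalar
    coeff′ x = if does (proj₁ x ≟ C₀) then 1# else 0#

    fin : ∀ x → ¬ (coeff′ x ≈ 0#) → x ∈ C ∷ []
    fin (x , x-rank) x≉0 with x ≟ C₀
    ... | no  _ = contradiction ≈-refl x≉0
    ... | yes refl with ≡-irrelevant x-rank C₀-rank
    ...   | refl = here refl

  chainModule : ℕ → RawLeftModule Scalar (a ⊔ ℓ ⊔ c) (ℓ ⊔ c)
  chainModule k = record
    { Carrierᴹ = Chain k
    ; _≈ᴹ_     = _≈ᶜ_
    ; _+ᴹ_     = _+ᶜ_
    ; _*ₗ_     = _·_
    ; 0ᴹ       = 0ᶜ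
    ; -ᴹ_      = -ᶜ_
    }

  IsLinear : ∀ {j k} → (Chain j → Chain k) → Set (a ⊔ ℓ ⊔ c)
  IsLinear {j} {k} = IsLeftModuleHomomorphism
    where open LeftModuleMorphisms (chainModule j) (chainModule k)

  -- The d-th component maps d-chains to (d − 1)-chains.
  Boundary : Set (a ⊔ ℓ ⊔ c)
  Boundary = ∀ d → Chain (suc d) → Chain d

  -- There is no boundary operator on (−1)-chains: all of them are cycles.
  IsCycle : Boundary → ∀ {k} → Pred (Chain k) (ℓ ⊔ c)
  IsCycle ∂ {zero}  Z = ⊤
  IsCycle ∂ {suc d} Z = ∂ d Z ≈ᶜ 0ᶜ

------------------------------------------------------------------------
-- Abstract cell complexes

record AbstractCellComplex {a ℓ : Level} (F : Field a ℓ) (c ℓ′ : Level)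
       : Set (lsuc (a ⊔ ℓ ⊔ c ⊔ ℓ′)) where
  field
    gradedPoset : GradedPoset c ℓ′

  open GradedPoset gradedPoset public
  open Chains F gradedPoset public

  field
    ∅         : Cell
    ∅-minimal : Minimal ∅
    ∅-unique  : ∀ x → Minimal x → x ≡ ∅
    ∅-rank    : rank ∅ ≡ 0

    n        : ℕ
    vertices : CellOfRank 1 ↔ Fin n

    closed-lattice : ∀ C → ClosedIsLattice C

    ∂         : Boundary
    ∂-linear  : ∀ d → IsLinear (∂ d)
    ∂-support : ∀ d (C : CellOfRank (suc d)) B → Supp (∂ d ⟦ C ⟧) B → B ⊑ C
    -- Part of "∂C is supported on the facets of C": the support is not
    -- empty.  If ∂C could vanish, the three-element poset ∅ < v < e with
    -- ∂e = 0 would satisfy all other axioms, but its simple 1-cycle e has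
    -- a facet graph with one vertex, which is not 2-connected.
    ∂-nonzero : ∀ d (C : CellOfRank (suc d)) → ¬ (∂ d ⟦ C ⟧ ≈ᶜ 0ᶜ)
    ∂-vertex  : ∀ v → ∂ 0 ⟦ v ⟧ ≈ᶜ ⟦ ∅ , ∅-rank ⟧
    ∂∂≈0      : ∀ d (Z : Chain (suc (suc d))) → ∂ d (∂ (suc d) Z) ≈ᶜ 0ᶜ

    closed-acyclic : ∀ d (C : CellOfRank (suc d)) (W : Chain d) →
                     IsCycle ∂ W → (∀ B → Supp W B → B ⊑ C) →
                     ∃[ s ] W ≈ᶜ s · ∂ d ⟦ C ⟧

  IsSimpleCycle : ∀ {k} → Pred (Chain k) (a ⊔ ℓ ⊔ c)
  IsSimpleCycle Z =
      IsCycle ∂ Z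
    × ¬ (Z ≈ᶜ 0ᶜ)
    × (∀ W → IsCycle ∂ W → (∀ x → Supp W x → Supp Z x) → ∃[ s ] W ≈ᶜ s · Z)

  Compatible : ∀ {k p} → Pred (CellOfRank k) p → Set (c ⊔ ℓ′ ⊔ p)
  Compatible S = ∃[ M ] (∀ x → S x → proj₁ x ≤ M)

  facetGraph : ∀ {d} → Chain (suc d) → Graph (CellOfRank (suc d)) ℓ (c ⊔ ℓ′)
  facetGraph {d} Z = record
    { Vertex = Supp Z
    ; Adj    = λ x y → x ≢ y × Σ[ B ∈ CellOfRank d ] (B ⊑ x × B ⊑ y)
    }

  BothContainOneOf : ∀ {d} → List (CellOfRank d) → Rel (CellOfRank (suc d)) (c ⊔ ℓ′)
  BothContainOneOf Q x y = Any (λ B → B ⊑ x × B ⊑ y) Q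

-- The key fact is that a (k − 1)-cycle covered by at most k compatible closed
-- cells of dimension at most k is the boundary of a combination of those of
-- these cells which have dimension k.  This goes by induction on k and on the
-- number of cells: the part of the cycle lying in one of the cells, x, has its
-- boundary covered by the meets of x with the other cells, so by induction it
-- can be closed up within those meets, and (A3) fills the resulting cycle
-- inside x; what remains is covered by the other cells.
--
-- If A is a connected component of the graph after the deletion, the boundary
-- of Z restricted to A is covered by the at most d deleted cells, so it equals
-- ∂Y with Y supported on the deleted d-cells.  Then Z|A − Y is a cycle
-- supported in Supp Z, hence a multiple of Z.  The scalar is nonzero because
-- of A, so no surviving cell of Z lies outside A.

{-# OPTIONS --safe #-}
module Submission where

open import Defs
open import Level using (Level; _⊔_)
open import Data.Nat.Base using (ℕ; suc; _+_; _≤_)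
open import Data.List.Base using (List; length)
open import Data.Product.Base using (_×_)

open import Algebra.Module.Morphism.Structures using (module LeftModuleMorphisms)
import Algebra.Properties.Group as GroupProperties
import Algebra.Properties.Ring as RingProperties
open import Data.Bool.Base using (if_then_else_)
open import Data.List.Base using ([]; _∷_; _++_; map; filter)
open import Data.List.Membership.Propositional using (_∈_; _∉_; find; lose)
open import Data.List.Membership.Propositional.Properties
  using (∈-map⁺; ∈-map⁻; ∈-++⁺ˡ; ∈-++⁺ʳ; ∈-++⁻; ∈-filter⁺; ∈-filter⁻)
import Data.List.Membership.DecPropositional as DecMembership
open import Data.List.Properties using (length-map; length-++; length-filter)
open import Data.List.Relation.Unary.Any as Any using (Any; here; there; any?)
open import Data.List.Relation.Unary.Any.Properties using (¬Any[])
open import Data.Nat.Base using (zero; s≤s; s≤s⁻¹)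
import Data.Nat.Properties as ℕ
open import Data.Product.Base using (Σ-syntax; ∃; ∃-syntax; _,_; proj₁; proj₂; map₂)
open import Data.Sum.Base using (_⊎_; inj₁; inj₂; [_,_]′)
open import Data.Unit.Polymorphic using (tt)
open import Function.Base using (id; _∘_)
open import Relation.Binary.Construct.Closure.ReflexiveTransitive as Star using (Star; ε; _◅_; _◅◅_)
open import Relation.Binary.Core using (Rel)
open import Relation.Binary.Definitions using (Decidable; DecidableEquality)
open import Relation.Binary.Lattice.Structures using (IsLattice)
open import Relation.Binary.PropositionalEquality
  using (_≡_; _≢_; refl; sym; trans; cong; subst)
import Relation.Binary.Reasoning.Setoid as SetoidReasoning
open import Relation.Binary.Structures using (IsDecPartialOrder)
open import Relation.Nullary.Decidable
  using (Dec; does; yes; no; map′; _×-dec_; _⊎-dec_; ¬?; decidable-stable)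
open import Relation.Nullary.Negation using (¬_; contradiction)
open import Relation.Unary using (Pred) renaming (Decidable to Decidable₁)

-- Floyd–Warshall: reachability in a finite graph, by recursion on the
-- list of permitted intermediate vertices, is decidable.
module Reachability {a e : Level} {A : Set a} {E : Rel A e}
                    (_≟_ : DecidableEquality A) (E? : Decidable E) where

  Reach : List A → Rel A (a ⊔ e)
  Reach []       x y = x ≡ y ⊎ E x y
  Reach (v ∷ vs) x y = Reach vs x y ⊎ (Reach vs x v × Reach vs v y)

  reach? : ∀ vs → Decidable (Reach vs)
  reach? []       x y = (x ≟ y) ⊎-dec E? x y
  reach? (v ∷ vs) x y = reach? vs x y ⊎-dec (reach? vs x v ×-dec reach? vs v y)

  reach-base : ∀ vs {x y} → x ≡ y ⊎ E x y → Reach vs x y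
  reach-base []       p = p
  reach-base (v ∷ vs) p = inj₁ (reach-base vs p)

  reach⇒star : ∀ vs {x y} → Reach vs x y → Star E x y
  reach⇒star []       (inj₁ refl)    = ε
  reach⇒star []       (inj₂ xy)      = xy ◅ ε
  reach⇒star (v ∷ vs) (inj₁ p)       = reach⇒star vs p
  reach⇒star (v ∷ vs) (inj₂ (p , q)) = reach⇒star vs p ◅◅ reach⇒star vs q

  -- Walks can be joined only at a permitted vertex. If both halves pass through `v`, the closed
  -- walk from `v` to `y` and back is cut out.
  reach-trans : ∀ vs {x y z} → y ∈ vs → Reach vs x y → Reach vs y z → Reach vs x z
  reach-trans (v ∷ vs) (here refl) p q = inj₂ ([ id , proj₁ ]′ p , [ id , proj₂ ]′ q)
  reach-trans (v ∷ vs) (there i) (inj₁ p)       (inj₁ q)       = inj₁ (reach-trans vs i p q)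
  reach-trans (v ∷ vs) (there i) (inj₁ p)       (inj₂ (q , r)) = inj₂ (reach-trans vs i p q , r)
  reach-trans (v ∷ vs) (there i) (inj₂ (p , q)) (inj₁ r)       = inj₂ (p , reach-trans vs i q r)
  reach-trans (v ∷ vs) (there i) (inj₂ (p , q)) (inj₂ (r , s)) = inj₂ (p , s)

star-target : ∀ {a v e} {A : Set a} (G : Graph A v e) {x y} →
              Vertex G x → Star (Edge G) x y → Vertex G y
star-target G vx ε                   = vx
star-target G vx ((_ , vy , _) ◅ ys) = star-target G vy ys

module CellComplex {a ℓ c ℓ′ : Level} (F : Field a ℓ) (P : AbstractCellComplex F c ℓ′) where

  open Field F
    renaming (_+_ to _⊕_; refl to ≈-refl; sym to ≈-sym; trans to ≈-trans)
    hiding (zero; Carrier)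
  open RingProperties ring using (-0#≈0#)
  open GroupProperties +-group using (//-rightDividesˡ)
  open AbstractCellComplex P renaming (_≤_ to _≼_; _≤?_ to _≼?_; _<_ to _≺_)
  open SetoidReasoning setoid

  module ≼ = IsDecPartialOrder isDecPartialOrder

  *-cancel-0 : ∀ s {t} → ¬ (s ≈ 0#) → s * t ≈ 0# → t ≈ 0#
  *-cancel-0 s {t} s≉0 st≈0 with inverse s s≉0
  ... | r , sr≈1 = begin
    t           ≈⟨ *-identityˡ t ⟨
    1# * t      ≈⟨ *-congʳ (≈-trans (*-comm r s) sr≈1) ⟨
    r * s * t   ≈⟨ *-assoc r s t ⟩
    r * (s * t) ≈⟨ *-congˡ st≈0 ⟩
    r * 0#      ≈⟨ zeroʳ r ⟩
    0#          ∎

  cell≡ : ∀ {k} {x y : CellOfRank k} → proj₁ x ≡ proj₁ y → x ≡ y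
  cell≡ {x = _ , p} {_ , q} refl = cong (_ ,_) (ℕ.≡-irrelevant p q)

  _≟ᶜ_ : ∀ {k} → DecidableEquality (CellOfRank k)
  x ≟ᶜ y = map′ cell≡ (cong proj₁) (proj₁ x ≟ proj₁ y)

  ≼∧rank≥⇒≡ : ∀ {x y} → x ≼ y → rank y ≤ rank x → x ≡ y
  ≼∧rank≥⇒≡ {x} {y} x≼y ry≤rx with x ≟ y
  ... | yes x≡y = x≡y
  ... | no  x≢y = contradiction (rank-mono (x≼y , x≢y)) (ℕ.≤⇒≯ ry≤rx)

  ⊑⇒≡ : ∀ {k} {x y : CellOfRank k} → x ⊑ y → x ≡ y
  ⊑⇒≡ {x = _ , refl} {_ , q} x⊑y = cell≡ (≼∧rank≥⇒≡ x⊑y (ℕ.≤-reflexive q))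

  -- Supports and restrictions of chains.

  supp? : ∀ {k} (Z : Chain k) → Decidable₁ (Supp Z)
  supp? Z x = ¬? (coeff Z x ≈? 0#)

  ∉supp⇒≈0 : ∀ {k} (Z : Chain k) {x} → ¬ Supp Z x → coeff Z x ≈ 0#
  ∉supp⇒≈0 Z {x} = decidable-stable (coeff Z x ≈? 0#)

  supp-+ : ∀ {k} (Y Z : Chain k) {x} → Supp (Y +ᶜ Z) x → Supp Y x ⊎ Supp Z x
  supp-+ Y Z {x} s with supp? Y x
  ... | yes y = inj₁ y
  ... | no ¬y = inj₂ λ z≈0 → s (≈-trans (+-cong (∉supp⇒≈0 Y ¬y) z≈0) (+-identityˡ 0#))

  supp-neg : ∀ {k} (Z : Chain k) {x} → Supp (-ᶜ Z) x → Supp Z x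
  supp-neg Z s z≈0 = s (≈-trans (-‿cong z≈0) -0#≈0#)

  restrict : ∀ {k p} {S : Pred (CellOfRank k) p} → Decidable₁ S → Chain k → Chain k
  restrict {k} S? Z = record
    { coeff  = r
    ; cells  = cells Z
    ; finite = λ x rx → finite Z x (supported x rx)
    }
    where
    r : CellOfRank k → _
    r x = if does (S? x) then coeff Z x else 0#

    supported : ∀ x → ¬ (r x ≈ 0#) → Supp Z x
    supported x rx with S? x
    ... | yes _ = rx
    ... | no  _ = contradiction ≈-refl rx

  module _ {k p} {S : Pred (CellOfRank k) p} (S? : Decidable₁ S) (Z : Chain k) where

    supp-restrict : ∀ {x} → Supp (restrict S? Z) x → S x × Supp Z x
    supp-restrict {x} s with S? x
    ... | yes Sx = Sx , s
    ... | no  _  = contradiction ≈-refl s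

    restrict-∈ : ∀ {x} → S x → coeff (restrict S? Z) x ≈ coeff Z x
    restrict-∈ {x} Sx with S? x
    ... | yes _  = ≈-refl
    ... | no ¬Sx = contradiction Sx ¬Sx

    restrict-split : restrict S? Z +ᶜ restrict (¬? ∘ S?) Z ≈ᶜ Z
    restrict-split x with S? x
    ... | yes _ = +-identityʳ _
    ... | no  _ = +-identityˡ _

  supp-⟦⟧ : ∀ {k} (C : CellOfRank k) {x} → Supp ⟦ C ⟧ x → x ≡ C
  supp-⟦⟧ C {x} s with finite ⟦ C ⟧ x s
  ... | here x≡C = x≡C

  supp-· : ∀ {k} s (Z : Chain k) {x} → Supp (s · Z) x → Supp Z x
  supp-· s Z sz z≈0 = sz (≈-trans (*-congˡ z≈0) (zeroʳ s))

  -- Boundaries of chains.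

  module ∂-hom (k : ℕ) where
    open LeftModuleMorphisms (chainModule (suc k)) (chainModule k)
    open IsLeftModuleHomomorphism (∂-linear k) public

  ∂-cycle : ∀ k (Z : Chain (suc k)) → IsCycle ∂ (∂ k Z)
  ∂-cycle zero    Z = tt
  ∂-cycle (suc k) Z = ∂∂≈0 k Z

  ∂-split : ∀ {k} {X Y Z : Chain (suc k)} → X +ᶜ Y ≈ᶜ Z → ∂ k X +ᶜ ∂ k Y ≈ᶜ ∂ k Z
  ∂-split {k} {X} {Y} e B = ≈-trans (≈-sym (∂-hom.+ᴹ-homo k X Y B)) (∂-hom.⟦⟧-cong k e B)

  -- The two boundaries cancel. Together with `∂-supp` this puts each boundary cell of one piece of
  -- a split cycle below a cell of either piece.
  supp-∂-complement : ∀ {k} {X Y Z : Chain (suc k)} → X +ᶜ Y ≈ᶜ Z → ∂ k Z ≈ᶜ 0ᶜ →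
                      ∀ {B} → Supp (∂ k X) B → Supp (∂ k Y) B
  supp-∂-complement {k} {X} {Y} {Z} split ∂Z≈0 {B} s e = s (begin
    coeff (∂ k X) B                    ≈⟨ +-identityʳ _ ⟨
    coeff (∂ k X) B ⊕ 0#               ≈⟨ +-congˡ e ⟨
    coeff (∂ k X) B ⊕ coeff (∂ k Y) B  ≈⟨ ∂-split split B ⟩
    coeff (∂ k Z) B                    ≈⟨ ∂Z≈0 B ⟩
    0#                                 ∎)

  ∂-− : ∀ {k} {X Y : Chain (suc k)} → ∂ k X ≈ᶜ ∂ k Y → ∂ k (X +ᶜ (-ᶜ Y)) ≈ᶜ 0ᶜ
  ∂-− {k} {X} {Y} e B = begin
    coeff (∂ k (X +ᶜ (-ᶜ Y))) B               ≈⟨ ∂-hom.+ᴹ-homo k X (-ᶜ Y) B ⟩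
    coeff (∂ k X) B ⊕ coeff (∂ k (-ᶜ Y)) B    ≈⟨ +-cong (e B) (∂-hom.-ᴹ-homo k Y B) ⟩
    coeff (∂ k Y) B ⊕ - coeff (∂ k Y) B       ≈⟨ -‿inverseʳ _ ⟩
    0#                                        ∎

  ∂-zero : ∀ {k} {Z : Chain (suc k)} → Z ≈ᶜ 0ᶜ → ∂ k Z ≈ᶜ 0ᶜ
  ∂-zero {k} e B = ≈-trans (∂-hom.⟦⟧-cong k e B) (∂-hom.0ᴹ-homo k B)

  -- `∂-support` speaks of single cells; linearity carries it over to chains, splitting off one
  -- listed cell `x` with its coefficient at a time.
  ∂-supp : ∀ {k} (Z : Chain (suc k)) {B} → Supp (∂ k Z) B → ∃[ C ] Supp Z C × B ⊑ C
  ∂-supp {k} Z {B} = go (cells Z) Z (finite Z)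
    where
    go : ∀ xs (Y : Chain (suc k)) → (∀ x → Supp Y x → x ∈ xs) →
         Supp (∂ k Y) B → ∃[ C ] Supp Y C × B ⊑ C
    go [] Y Y⊆ s = contradiction (∂-zero (λ x → ∉supp⇒≈0 Y λ y → ¬Any[] (Y⊆ x y)) B) s
    go (x ∷ xs) Y Y⊆ s = [ head , tail ]′
      (supp-+ (∂ k X) (∂ k Y′) λ e → s (≈-trans (≈-sym (∂-split split B)) e))
      where
      ≢x? : Decidable₁ (λ y → ¬ (y ≡ x))
      ≢x? y = ¬? (y ≟ᶜ x)

      X Y′ : Chain (suc k)
      X  = coeff Y x · ⟦ x ⟧
      Y′ = restrict ≢x? Y

      split : X +ᶜ Y′ ≈ᶜ Y
      split y with proj₁ y ≟ proj₁ x
      ... | no  _ = ≈-trans (+-congʳ (zeroʳ _)) (+-identityˡ _)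
      ... | yes e with refl ← cell≡ {x = y} {x} e = ≈-trans (+-identityʳ _) (*-identityʳ _)

      head : Supp (∂ k X) B → ∃[ C ] Supp Y C × B ⊑ C
      head t = x , (λ y≈0 → u (≈-trans (*-congʳ y≈0) (zeroˡ _))) ,
               ∂-support k x B (supp-· (coeff Y x) (∂ k ⟦ x ⟧) u)
        where
        u : Supp (coeff Y x · ∂ k ⟦ x ⟧) B
        u e = t (≈-trans (∂-hom.*ₗ-homo k (coeff Y x) ⟦ x ⟧ B) e)

      tail : Supp (∂ k Y′) B → ∃[ C ] Supp Y C × B ⊑ C
      tail t with go xs Y′ Y′⊆ t
        where
        Y′⊆ : ∀ y → Supp Y′ y → y ∈ xs
        Y′⊆ y s with supp-restrict ≢x? Y s
        ... | y≢x , y∈Y with Y⊆ y y∈Y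
        ...   | here y≡x = contradiction y≡x y≢x
        ...   | there i  = i
      ... | C , C∈Y′ , B⊑C = C , proj₂ (supp-restrict ≢x? Y C∈Y′) , B⊑C

  -- For rank x = k + 2 this is axiom (A3).  For rank x = k + 1 the cycle is
  -- a multiple of x itself, hence zero because ∂x ≠ 0.
  fill-closed : ∀ {k} x → rank x ≤ suc (suc k) → (V : Chain (suc k)) →
                IsCycle ∂ V → (∀ B → Supp V B → proj₁ B ≼ x) →
                Σ[ U ∈ Chain (suc (suc k)) ] V ≈ᶜ ∂ (suc k) U × (∀ C → Supp U C → proj₁ C ≡ x)
  fill-closed {k} x rx V ∂V≈0 V≼x with rank x ℕ.≟ suc (suc k)
  ... | yes e with closed-acyclic (suc k) (x , e) V ∂V≈0 V≼x
  ...   | s , V≈ = s · ⟦ x , e ⟧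
                 , (λ B → ≈-trans (V≈ B) (≈-sym (∂-hom.*ₗ-homo (suc k) s ⟦ x , e ⟧ B)))
                 , λ C t → cong proj₁ (supp-⟦⟧ (x , e) {C} (supp-· s ⟦ x , e ⟧ {C} t))
  fill-closed {k} x rx V ∂V≈0 V≼x | no ≢ =
    0ᶜ , (λ B → ≈-trans (V≈0 B) (≈-sym (∂-hom.0ᴹ-homo (suc k) B)))
       , λ C t → contradiction ≈-refl t
    where
    V≈0 : V ≈ᶜ 0ᶜ
    V≈0 B = ∉supp⇒≈0 V λ s → ∂-nonzero k B λ A →
      *-cancel-0 (coeff V B) s (begin
        coeff V B * coeff (∂ k ⟦ B ⟧) A    ≈⟨ ∂-hom.*ₗ-homo k (coeff V B) ⟦ B ⟧ A ⟨
        coeff (∂ k (coeff V B · ⟦ B ⟧)) A  ≈⟨ ∂-hom.⟦⟧-cong k (multiple s) A ⟨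
        coeff (∂ k V) A                    ≈⟨ ∂V≈0 A ⟩
        0#                                 ∎)
      where
      -- This handles every rank of `x` below `suc (suc k)`: `B` has rank `suc k` and lies below
      -- `x`, whose rank is no larger.
      B≡x : Supp V B → proj₁ B ≡ x
      B≡x s = ≼∧rank≥⇒≡ (V≼x B s)
        (ℕ.≤-trans (s≤s⁻¹ (ℕ.≤∧≢⇒< rx ≢)) (ℕ.≤-reflexive (sym (proj₂ B))))

      multiple : Supp V B → V ≈ᶜ coeff V B · ⟦ B ⟧
      multiple s C with proj₁ C ≟ proj₁ B
      ... | yes e with refl ← cell≡ {x = C} {B} e = ≈-sym (*-identityʳ _)
      ... | no C≢B = ≈-trans
        (∉supp⇒≈0 V λ t → C≢B (cong proj₁ (⊑⇒≡ {x = C} {B}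
          (subst (proj₁ C ≼_) (sym (B≡x s)) (V≼x C t)))))
        (≈-sym (zeroʳ _))

  -- Filling cycles covered by few compatible cells.

  module Below (M : Cell) where

    lattice = proj₂ (proj₂ (closed-lattice M))

    -- Meets in the lattice of cells below M; the value is junk unless both
    -- arguments are below M.
    _∧_ : Cell → Cell → Cell
    x ∧ y with x ≼? M | y ≼? M
    ... | yes p | yes q = proj₁ (proj₁ (proj₂ (closed-lattice M)) (x , p) (y , q))
    ... | _     | _     = x

    ∧-isMeet : ∀ {x y} → x ≼ M → y ≼ M →
               (x ∧ y) ≼ x × (x ∧ y) ≼ y × (∀ {z} → z ≼ x → z ≼ y → z ≼ (x ∧ y))
    ∧-isMeet {x} {y} x≼M y≼M with x ≼? M | y ≼? M
    ... | no ¬p | _     = contradiction x≼M ¬p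
    ... | yes _ | no ¬q = contradiction y≼M ¬q
    ... | yes p | yes q =
      IsLattice.x∧y≤x lattice (x , p) (y , q) , IsLattice.x∧y≤y lattice (x , p) (y , q) ,
      λ {z} z≼x z≼y → IsLattice.∧-greatest lattice {z , ≼.trans z≼x p} {x , p} {y , q} z≼x z≼y

    -- Strictness supplies the drop in rank that drives the induction.
    ∧-≺ : ∀ {x y} → x ≼ M → y ≼ M → ¬ (x ≼ y) → (x ∧ y) ≺ x
    ∧-≺ x≼M y≼M x⋠y with ∧-isMeet x≼M y≼M
    ... | m≼x , m≼y , _ = m≼x , λ m≡x → x⋠y (subst (_≼ _) m≡x m≼y)

    -- Asking for membership in `L`, rather than for lying below a cell of `L`, pins `Y` to known
    -- cells: meets in the induction, deleted cells in the application. Only members of rank `suc k`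
    -- can occur in `Y`.
    Filled : ∀ {k} → List Cell → Chain k → Set _
    Filled {k} L W =
      Σ[ Y ∈ Chain (suc k) ] W ≈ᶜ ∂ k Y × (∀ C → Supp Y C → proj₁ C ∈ L)

    Fillable : ℕ → List Cell → Set _
    Fillable k L =
      (W : Chain k) → IsCycle ∂ W → (∀ B → Supp W B → Any (proj₁ B ≼_) L) → Filled L W

    -- Quantified over all lists, since the step to `suc k` applies it to a list of meets. Rank
    -- `suc k` is dimension `k`.
    FillableBelow : ℕ → Set _
    FillableBelow k = ∀ L → length L ≤ k →
      (∀ {x} → x ∈ L → x ≼ M) → (∀ {x} → x ∈ L → rank x ≤ suc k) → Fillable k L

    fillable-[] : ∀ k → Fillable k []
    fillable-[] k W _ cover =
      0ᶜ , (λ B → ≈-trans (∉supp⇒≈0 W λ s → ¬Any[] (cover B s)) (≈-sym (∂-hom.0ᴹ-homo k B)))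
         , λ C t → contradiction ≈-refl t

    -- `L` alone already covers the cycle. The case is split off because the meet of `x` with a cell
    -- above it is `x` itself, so the rank would not drop.
    fillable-redundant : ∀ {k x L} → Any (x ≼_) L → Fillable k L → Fillable k (x ∷ L)
    fillable-redundant {k} {x} {L} x≼L fill-L W ∂W≈0 cover with fill-L W ∂W≈0 cover′
      where
      cover′ : ∀ B → Supp W B → Any (proj₁ B ≼_) L
      cover′ B s with cover B s
      ... | here B≼x = Any.map (≼.trans B≼x) x≼L
      ... | there i  = i
    ... | Y , W≈∂Y , Y⊆L = Y , W≈∂Y , λ C t → there (Y⊆L C t)

    -- W = (Wˣ − Y) + (Y + Wᵒ), where the first summand is a cycle in the closed
    -- cell x and the second one is a cycle covered by L.
    fill-glue : ∀ {k x L} {W : Chain (suc k)} (Wˣ Wᵒ Y : Chain (suc k)) →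
      Wˣ +ᶜ Wᵒ ≈ᶜ W → ∂ k W ≈ᶜ 0ᶜ → ∂ k Wˣ ≈ᶜ ∂ k Y → rank x ≤ suc (suc k) →
      (∀ B → Supp Wˣ B → proj₁ B ≼ x) →
      (∀ B → Supp Wᵒ B → Any (proj₁ B ≼_) L) →
      (∀ B → Supp Y B → proj₁ B ≼ x × Any (proj₁ B ≼_) L) →
      Fillable (suc k) L → Filled (x ∷ L) W
    fill-glue {k} {x} {L} {W} Wˣ Wᵒ Y split ∂W≈0 ∂Wˣ≈∂Y rankx Wˣ≼x Wᵒ≼L Y≼ fill-L
      with fill-closed x rankx (Wˣ +ᶜ (-ᶜ Y)) (∂-− ∂Wˣ≈∂Y) Wˣ−Y≼x
         | fill-L (Y +ᶜ Wᵒ) Y+Wᵒ-cycle Y+Wᵒ≼L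
      where
      Wˣ−Y≼x : ∀ B → Supp (Wˣ +ᶜ (-ᶜ Y)) B → proj₁ B ≼ x
      Wˣ−Y≼x B = [ Wˣ≼x B , proj₁ ∘ Y≼ B ∘ supp-neg Y ]′ ∘ supp-+ Wˣ (-ᶜ Y)

      Y+Wᵒ≼L : ∀ B → Supp (Y +ᶜ Wᵒ) B → Any (proj₁ B ≼_) L
      Y+Wᵒ≼L B = [ proj₂ ∘ Y≼ B , Wᵒ≼L B ]′ ∘ supp-+ Y Wᵒ

      Y+Wᵒ-cycle : ∂ k (Y +ᶜ Wᵒ) ≈ᶜ 0ᶜ
      Y+Wᵒ-cycle A = begin
        coeff (∂ k (Y +ᶜ Wᵒ)) A              ≈⟨ ∂-hom.+ᴹ-homo k Y Wᵒ A ⟩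
        coeff (∂ k Y) A ⊕ coeff (∂ k Wᵒ) A   ≈⟨ +-congʳ (∂Wˣ≈∂Y A) ⟨
        coeff (∂ k Wˣ) A ⊕ coeff (∂ k Wᵒ) A  ≈⟨ ∂-split split A ⟩
        coeff (∂ k W) A                      ≈⟨ ∂W≈0 A ⟩
        0#                                   ∎
    ... | U , Wˣ−Y≈∂U , U⊆x | V , Y+Wᵒ≈∂V , V⊆L = U +ᶜ V , W≈ , U+V⊆
      where
      W≈ : W ≈ᶜ ∂ (suc k) (U +ᶜ V)
      W≈ B = begin
        coeff W B                                      ≈⟨ split B ⟨
        coeff Wˣ B ⊕ coeff Wᵒ B                        ≈⟨ +-congʳ (//-rightDividesˡ _ _) ⟨
        (Wˣ−Y ⊕ coeff Y B) ⊕ coeff Wᵒ B                ≈⟨ +-assoc _ _ _ ⟩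
        Wˣ−Y ⊕ (coeff Y B ⊕ coeff Wᵒ B)                ≈⟨ +-cong (Wˣ−Y≈∂U B) (Y+Wᵒ≈∂V B) ⟩
        coeff (∂ (suc k) U) B ⊕ coeff (∂ (suc k) V) B  ≈⟨ ∂-hom.+ᴹ-homo (suc k) U V B ⟨
        coeff (∂ (suc k) (U +ᶜ V)) B                   ∎
        where Wˣ−Y = coeff Wˣ B ⊕ - coeff Y B

      U+V⊆ : ∀ C → Supp (U +ᶜ V) C → proj₁ C ∈ x ∷ L
      U+V⊆ C = [ here ∘ U⊆x C , there ∘ V⊆L C ]′ ∘ supp-+ U V

    -- Without `x` at most `k` cells are left, and their meets with `x`, lying strictly below it,
    -- have rank at most `suc k`; so `fill-meets` applies to the boundary of `Wˣ`.
    fillable-irredundant : ∀ {k} x L → length L ≤ k →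
      (∀ {y} → y ∈ x ∷ L → y ≼ M) → (∀ {y} → y ∈ x ∷ L → rank y ≤ suc (suc k)) →
      ¬ Any (x ≼_) L → FillableBelow k → Fillable (suc k) L → Fillable (suc k) (x ∷ L)
    fillable-irredundant {k} x L |L|≤k L≼M rankL x⋠L fill-meets fill-L W ∂W≈0 cover =
      glue (fill-meets meets
        (ℕ.≤-trans (ℕ.≤-reflexive (length-map (x ∧_) L)) |L|≤k)
        (λ i → ≼.trans (proj₁ (proj₁ (meet-bounds i))) x≼M)
        (λ i → s≤s⁻¹ (ℕ.≤-trans (rank-mono (proj₁ (meet-bounds i))) (rankL (here refl))))
        (∂ k Wˣ) (∂-cycle k Wˣ) ∂Wˣ-cover)
      where
      x≼M : x ≼ M
      x≼M = L≼M (here refl)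

      meets : List Cell
      meets = map (x ∧_) L

      meet-bounds : ∀ {m} → m ∈ meets → m ≺ x × Any (m ≼_) L
      meet-bounds i with ∈-map⁻ (x ∧_) i
      ... | y , y∈L , refl =
        ∧-≺ x≼M (L≼M (there y∈L)) (λ x≼y → x⋠L (lose y∈L x≼y)) ,
        lose y∈L (proj₁ (proj₂ (∧-isMeet x≼M (L≼M (there y∈L)))))

      ≼x? : Decidable₁ {A = CellOfRank (suc k)} (λ B → proj₁ B ≼ x)
      ≼x? B = proj₁ B ≼? x

      Wˣ Wᵒ : Chain (suc k)
      Wˣ = restrict ≼x? W
      Wᵒ = restrict (¬? ∘ ≼x?) W

      Wˣ≼x : ∀ B → Supp Wˣ B → proj₁ B ≼ x
      Wˣ≼x B = proj₁ ∘ supp-restrict ≼x? W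

      Wᵒ≼L : ∀ B → Supp Wᵒ B → Any (proj₁ B ≼_) L
      Wᵒ≼L B s with supp-restrict (¬? ∘ ≼x?) W s
      ... | B⋠x , t with cover B t
      ...   | here B≼x = contradiction B≼x B⋠x
      ...   | there i  = i

      -- By cancellation `A` lies on a cell of `Wˣ` and on one of `Wᵒ`, hence below `x` and below
      -- some `y` in `L`, hence below their meet.
      ∂Wˣ-cover : ∀ A → Supp (∂ k Wˣ) A → Any (proj₁ A ≼_) meets
      ∂Wˣ-cover A s with ∂-supp Wˣ s
                      | ∂-supp Wᵒ {A} (supp-∂-complement {Y = Wᵒ} (restrict-split ≼x? W) ∂W≈0 s)
      ... | B , B∈ , A⊑B | C , C∈ , A⊑C with find (Wᵒ≼L C C∈)
      ...   | y , y∈L , C≼y = lose (∈-map⁺ (x ∧_) y∈L)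
        (proj₂ (proj₂ (∧-isMeet x≼M (L≼M (there y∈L))))
          (≼.trans A⊑B (Wˣ≼x B B∈)) (≼.trans A⊑C C≼y))

      glue : Filled meets (∂ k Wˣ) → Filled (x ∷ L) W
      glue (Y , ∂Wˣ≈∂Y , Y⊆) =
        fill-glue Wˣ Wᵒ Y (restrict-split ≼x? W) ∂W≈0 ∂Wˣ≈∂Y (rankL (here refl)) Wˣ≼x Wᵒ≼L
          -- The cells of `Y` are themselves meets, so they lie below `x` and below a member of `L`
          -- at once.
          (λ B t → let B≺x , B≼L = meet-bounds (Y⊆ B t) in proj₁ B≺x , B≼L)
          fill-L

    fillable-∷ : ∀ {k} x L → length L ≤ k →
      (∀ {y} → y ∈ x ∷ L → y ≼ M) → (∀ {y} → y ∈ x ∷ L → rank y ≤ suc (suc k)) →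
      FillableBelow k → Fillable (suc k) L → Fillable (suc k) (x ∷ L)
    fillable-∷ x L |L|≤k L≼M rankL fill-meets fill-L with any? (x ≼?_) L
    ... | yes x≼L = fillable-redundant x≼L fill-L
    ... | no  x⋠L = fillable-irredundant x L |L|≤k L≼M rankL x⋠L fill-meets fill-L

    -- Lexicographic induction on `k` and `L`. For `k = 0` the length bound leaves only the empty
    -- list.
    fillable : ∀ k → FillableBelow k
    fillable k       []      _           _   _     = fillable-[] k
    fillable (suc k) (x ∷ L) (s≤s |L|≤k) L≼M rankL =
      fillable-∷ x L |L|≤k L≼M rankL (fillable k)
        (fillable (suc k) L (ℕ.m≤n⇒m≤1+n |L|≤k) (L≼M ∘ there) (rankL ∘ there))

    -- Common facets of compatible cells.

    module _ {d : ℕ} {x y : CellOfRank (suc d)}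
             (x≼M : proj₁ x ≼ M) (y≼M : proj₁ y ≼ M) (x≢y : x ≢ y) where

      -- Distinct cells of equal rank are incomparable, so their meet has rank at most `d`, while
      -- `B` of rank `d` lies below it. Thus a common facet is unique, which later identifies it
      -- with a chosen cell of `Q`.
      commonFacet≡∧ : (B : CellOfRank d) → B ⊑ x → B ⊑ y → proj₁ B ≡ proj₁ x ∧ proj₁ y
      commonFacet≡∧ (B , refl) B⊑x B⊑y =
        ≼∧rank≥⇒≡ (proj₂ (proj₂ (∧-isMeet x≼M y≼M)) B⊑x B⊑y)
          (s≤s⁻¹ (ℕ.≤-trans (rank-mono (∧-≺ x≼M y≼M (x≢y ∘ ⊑⇒≡))) (ℕ.≤-reflexive (proj₂ x))))

      -- The meet is the only candidate, so its rank decides the question without a search over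
      -- cells.
      commonFacet? : Dec (Σ[ B ∈ CellOfRank d ] (B ⊑ x × B ⊑ y))
      commonFacet? with rank (proj₁ x ∧ proj₁ y) ℕ.≟ d | ∧-isMeet x≼M y≼M
      ... | yes e | m≼x , m≼y , _ = yes ((_ , e) , m≼x , m≼y)
      ... | no ¬e | _ = no λ (B , B⊑x , B⊑y) →
              ¬e (trans (cong rank (sym (commonFacet≡∧ B B⊑x B⊑y))) (proj₂ B))

  -- Deletions from the facet graph of a simple cycle.

  module SimpleCycle {d : ℕ} (Z : Chain (suc d)) (Z-simple : IsSimpleCycle Z)
                     (Z-compatible : Compatible (Supp Z)) where

    M   = proj₁ Z-compatible
    Z≼M = proj₂ Z-compatible

    open Below M

    ∂Z≈0    = proj₁ Z-simple
    Z≉0     = proj₁ (proj₂ Z-simple)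
    Z-spans = proj₂ (proj₂ Z-simple)

    module Deletion (R : List (CellOfRank (suc d))) (Q : List (CellOfRank d))
                    (|R|+|Q|≤d : length R + length Q ≤ d) where

      G = deleteEdges (BothContainOneOf Q) (deleteVertices R (facetGraph Z))

      open DecMembership (_≟ᶜ_ {suc d}) using (_∈?_)

      ≼M? : Decidable₁ {A = CellOfRank d} (λ q → proj₁ q ≼ M)
      ≼M? q = proj₁ q ≼? M

      -- Filtering keeps what affects the graph: a cell of `R` outside `Supp Z` is no vertex, and a
      -- cell of `Q` not below `M` lies on no cell of `Z`. What remains lies below `M`, as
      -- `fillable` demands, and confines the filling to `Supp Z`.
      R∩Z Q≼M L : List Cell
      R∩Z = map proj₁ (filter (supp? Z) R)
      Q≼M = map proj₁ (filter ≼M? Q)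
      L   = R∩Z ++ Q≼M

      |R∩Z|≤|R| : length R∩Z ≤ length R
      |R∩Z|≤|R| = ℕ.≤-trans (ℕ.≤-reflexive (length-map proj₁ (filter (supp? Z) R)))
                            (length-filter (supp? Z) R)

      |Q≼M|≤|Q| : length Q≼M ≤ length Q
      |Q≼M|≤|Q| = ℕ.≤-trans (ℕ.≤-reflexive (length-map proj₁ (filter ≼M? Q)))
                            (length-filter ≼M? Q)

      |L|≤d : length L ≤ d
      |L|≤d = ℕ.≤-trans (ℕ.≤-reflexive (length-++ R∩Z))
                        (ℕ.≤-trans (ℕ.+-mono-≤ |R∩Z|≤|R| |Q≼M|≤|Q|) |R|+|Q|≤d)

      ∈R∩Z⁺ : ∀ {x} → x ∈ R → Supp Z x → proj₁ x ∈ R∩Z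
      ∈R∩Z⁺ x∈R x∈Z = ∈-map⁺ proj₁ (∈-filter⁺ (supp? Z) x∈R x∈Z)

      ∈R∩Z⁻ : ∀ {x} → x ∈ R∩Z → Σ[ r ∈ CellOfRank (suc d) ] x ≡ proj₁ r × r ∈ R × Supp Z r
      ∈R∩Z⁻ i with ∈-map⁻ proj₁ i
      ... | r , j , x≡r = r , x≡r , ∈-filter⁻ (supp? Z) {xs = R} j

      ∈Q≼M⁻ : ∀ {x} → x ∈ Q≼M → x ≼ M × rank x ≡ d
      ∈Q≼M⁻ i with ∈-map⁻ proj₁ i
      ... | q , j , refl = proj₂ (∈-filter⁻ ≼M? {xs = Q} j) , proj₂ q

      R∩Z-bounds : ∀ {x} → x ∈ R∩Z → x ≼ M × rank x ≡ suc d
      R∩Z-bounds i with ∈R∩Z⁻ i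
      ... | r , refl , _ , r∈Z = Z≼M r r∈Z , proj₂ r

      L≼M : ∀ {x} → x ∈ L → x ≼ M
      L≼M = [ proj₁ ∘ R∩Z-bounds , proj₁ ∘ ∈Q≼M⁻ ]′ ∘ ∈-++⁻ R∩Z

      rankL : ∀ {x} → x ∈ L → rank x ≤ suc d
      rankL = [ ℕ.≤-reflexive ∘ proj₂ ∘ R∩Z-bounds
              , ℕ.m≤n⇒m≤1+n ∘ ℕ.≤-reflexive ∘ proj₂ ∘ ∈Q≼M⁻ ]′ ∘ ∈-++⁻ R∩Z

      -- Rank separates the two halves of `L`: the members from `Q` have rank `d`, so a filling by
      -- cells of rank `suc d` uses deleted vertices only.
      ∈L⇒∈R∩Z : (C : CellOfRank (suc d)) → proj₁ C ∈ L → C ∈ R × Supp Z C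
      ∈L⇒∈R∩Z C i with ∈-++⁻ R∩Z i
      ... | inj₂ j = contradiction (trans (sym (proj₂ (∈Q≼M⁻ j))) (proj₂ C)) (ℕ.<⇒≢ (ℕ.n<1+n d))
      ... | inj₁ j with ∈R∩Z⁻ j
      ...   | r , C≡r , r∈R∩Z with refl ← cell≡ {x = C} {r} C≡r = r∈R∩Z

      vertex? : Decidable₁ (Vertex G)
      vertex? x = supp? Z x ×-dec ¬? (x ∈? R)

      -- If all of Supp Z were deleted, Z would be covered by at most d cells of
      -- its own dimension, hence would bound a chain without any cells.
      nonempty : ∃ (Vertex G)
      nonempty with any? vertex? (cells Z)
      ... | yes v = map₂ proj₂ (find v)
      ... | no ¬v = contradiction Z≈0 Z≉0
        where
        cover : ∀ x → Supp Z x → Any (proj₁ x ≼_) R∩Z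
        cover x s with x ∈? R
        ... | yes x∈R = lose (∈R∩Z⁺ x∈R s) ≼.refl
        ... | no  x∉R = contradiction (lose (finite Z x s) (s , x∉R)) ¬v

        filling = fillable (suc d) R∩Z
          (ℕ.m≤n⇒m≤1+n (ℕ.≤-trans |R∩Z|≤|R| (ℕ.≤-trans (ℕ.m≤m+n _ _) |R|+|Q|≤d)))
          (proj₁ ∘ R∩Z-bounds) (ℕ.m≤n⇒m≤1+n ∘ ℕ.≤-reflexive ∘ proj₂ ∘ R∩Z-bounds)
          Z ∂Z≈0 cover

        Z≈0 : Z ≈ᶜ 0ᶜ
        Z≈0 x = ≈-trans (proj₁ (proj₂ filling) x) (∂-zero (λ C → ∉supp⇒≈0 (proj₁ filling) λ t →
          ℕ.<⇒≢ (ℕ.n<1+n (suc d))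
            (trans (sym (proj₂ (R∩Z-bounds (proj₂ (proj₂ filling) C t)))) (proj₂ C))) x)

      containOneOf? : Decidable (BothContainOneOf Q)
      containOneOf? x y = any? (λ B → (proj₁ B ≼? proj₁ x) ×-dec (proj₁ B ≼? proj₁ y)) Q

      -- Makes reachability decidable, so that `Z` can be restricted to a component.
      edge? : Decidable (Edge G)
      edge? x y with vertex? x | vertex? y | x ≟ᶜ y
      ... | no ¬vx | _      | _       = no (¬vx ∘ proj₁)
      ... | yes _  | no ¬vy | _       = no (¬vy ∘ proj₁ ∘ proj₂)
      ... | yes _  | yes _  | yes x≡y = no λ (_ , _ , (x≢y , _) , _) → x≢y x≡y
      ... | yes vx | yes vy | no x≢y
        with commonFacet? (Z≼M x (proj₁ vx)) (Z≼M y (proj₁ vy)) x≢y | containOneOf? x y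
      ...   | no ¬B | _     = no λ (_ , _ , (_ , B) , _) → ¬B B
      ...   | yes _ | yes q = no λ (_ , _ , _ , ¬q) → ¬q q
      ...   | yes B | no ¬q = yes (vx , vy , (x≢y , B) , ¬q)

      open Reachability _≟ᶜ_ edge?

      -- The component of a vertex.

      module Component (x : CellOfRank (suc d)) (vx : Vertex G x) where

        -- `cells Z` contains all of `Supp Z`, so these intermediate vertices suffice to reach the
        -- whole component.
        InA : Pred (CellOfRank (suc d)) _
        InA = Reach (cells Z) x

        inA? : Decidable₁ InA
        inA? = reach? (cells Z) x

        A-vertex : ∀ {y} → InA y → Vertex G y
        A-vertex = star-target G vx ∘ reach⇒star (cells Z)

        A-closed : ∀ {y z} → InA y → Edge G y z → InA z
        A-closed {y} Ay yz = reach-trans (cells Z) (finite Z y (proj₁ (A-vertex Ay)))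
                               Ay (reach-base (cells Z) (inj₂ yz))

        ∈A≢∉A : ∀ {y z} → InA y → ¬ InA z → y ≢ z
        ∈A≢∉A Ay ¬Az refl = ¬Az Ay

        Zᴬ Zᵒ : Chain (suc d)
        Zᴬ = restrict inA? Z
        Zᵒ = restrict (¬? ∘ inA?) Z

        -- A facet of A on which ∂Zᴬ does not vanish also lies on a cell outside
        -- A; this cell is deleted, or else the common facet is one of Q.
        ∂Zᴬ-cover : ∀ B → Supp (∂ d Zᴬ) B → Any (proj₁ B ≼_) L
        ∂Zᴬ-cover B s with ∂-supp Zᴬ s
                        | ∂-supp Zᵒ {B} (supp-∂-complement {Y = Zᵒ} (restrict-split inA? Z) ∂Z≈0 s)
        ... | y , y∈ , B⊑y | z , z∈ , B⊑z
          with supp-restrict inA? Z y∈ | supp-restrict (¬? ∘ inA?) Z z∈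
        ...   | Ay , y∈Z | ¬Az , z∈Z with z ∈? R
        ...     | yes z∈R = lose (∈-++⁺ˡ (∈R∩Z⁺ z∈R z∈Z)) B⊑z
        ...     | no  z∉R with containOneOf? y z
        ...       | no ¬q = contradiction
                    (A-closed Ay (A-vertex Ay , (z∈Z , z∉R) , (∈A≢∉A Ay ¬Az , B , B⊑y , B⊑z) , ¬q)) ¬Az
        ...       | yes q with find q
        ...         | b , b∈Q , b⊑y , b⊑z = lose (∈-++⁺ʳ R∩Z (∈-map⁺ proj₁
                        (∈-filter⁺ ≼M? b∈Q (≼.trans b⊑y (Z≼M y y∈Z)))))
                      (≼.reflexive (trans (commonFacet≡∧ y≼M z≼M y≢z B B⊑y B⊑z)
                                          (sym (commonFacet≡∧ y≼M z≼M y≢z b b⊑y b⊑z))))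
          where
          y≼M = Z≼M y y∈Z
          z≼M = Z≼M z z∈Z
          y≢z = ∈A≢∉A Ay ¬Az

        Zᴬ−Y⊆Z : (Y : Chain (suc d)) → (∀ C → Supp Y C → C ∈ R × Supp Z C) →
                 ∀ C → Supp (Zᴬ +ᶜ (-ᶜ Y)) C → Supp Z C
        Zᴬ−Y⊆Z Y Y⊆ C =
          [ proj₂ ∘ supp-restrict inA? Z , proj₂ ∘ Y⊆ C ∘ supp-neg Y ]′ ∘ supp-+ Zᴬ (-ᶜ Y)

        -- Only cells outside `R` are compared, because there the filling `Y` vanishes and `Zᴬ`
        -- agrees with the cycle `Zᴬ − Y`.
        Multiple : Set _
        Multiple = ∃[ s ] (∀ {y} → y ∉ R → coeff Zᴬ y ≈ s * coeff Z y)

        filled⇒multiple : Filled L (∂ d Zᴬ) → Multiple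
        filled⇒multiple (Y , ∂Zᴬ≈∂Y , Y⊆L) =
          map₂ (λ Zᴬ−Y≈sZ {y} y∉R → ≈-trans (≈-sym (Zᴬ−Y≈Zᴬ y∉R)) (Zᴬ−Y≈sZ y))
               (Z-spans (Zᴬ +ᶜ (-ᶜ Y)) (∂-− ∂Zᴬ≈∂Y) (Zᴬ−Y⊆Z Y λ C → ∈L⇒∈R∩Z C ∘ Y⊆L C))
          where
          Zᴬ−Y≈Zᴬ : ∀ {y} → y ∉ R → coeff (Zᴬ +ᶜ (-ᶜ Y)) y ≈ coeff Zᴬ y
          Zᴬ−Y≈Zᴬ {y} y∉R = ≈-trans
            (+-congˡ (∉supp⇒≈0 (-ᶜ Y) (y∉R ∘ proj₁ ∘ ∈L⇒∈R∩Z y ∘ Y⊆L y ∘ supp-neg Y)))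
            (+-identityʳ _)

        multiple⇒all-reached : Multiple → ∀ y → Vertex G y → InA y
        multiple⇒all-reached (s , Zᴬ≈sZ) y (y∈Z , y∉R) = decidable-stable (inA? y) λ ¬Ay →
          y∈Z (*-cancel-0 s s≉0
            (≈-trans (≈-sym (Zᴬ≈sZ y∉R))
                     (∉supp⇒≈0 Zᴬ (¬Ay ∘ proj₁ ∘ supp-restrict inA? Z))))
          where
          s≉0 : ¬ (s ≈ 0#)
          s≉0 s≈0 = proj₁ vx (begin
            coeff Z x      ≈⟨ restrict-∈ inA? Z (reach-base (cells Z) (inj₁ refl)) ⟨
            coeff Zᴬ x     ≈⟨ Zᴬ≈sZ (proj₂ vx) ⟩
            s * coeff Z x  ≈⟨ *-congʳ s≈0 ⟩
            0# * coeff Z x ≈⟨ zeroˡ _ ⟩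
            0#             ∎)

        all-reached : ∀ y → Vertex G y → InA y
        all-reached = multiple⇒all-reached (filled⇒multiple
          (fillable d L |L|≤d L≼M rankL (∂ d Zᴬ) (∂-cycle d Zᴬ) ∂Zᴬ-cover))

      connected : Connected G
      connected = nonempty , λ x y vx vy → reach⇒star (cells Z) (Component.all-reached x vx y vy)

    -- The case of an empty `Q`: fewer than `suc d` vertices are at most `d`, and walks carry over
    -- once the vacuous condition on edges is forgotten.
    vertexConnected : VertexConnected (suc d) (facetGraph Z)
    vertexConnected S _ |S|<1+d =
      map₂ (λ star x y vx vy → Star.map (λ (u , v , adj , _) → u , v , adj) (star x y vx vy))
           (Deletion.connected S [] (ℕ.≤-trans (ℕ.≤-reflexive (ℕ.+-identityʳ _)) (s≤s⁻¹ |S|<1+d)))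

theorem5p8 : {a ℓ c ℓ′ : Level} (F : Field a ℓ) (P : AbstractCellComplex F c ℓ′) →
    let open AbstractCellComplex P hiding (_≤_) in
    (d : ℕ) → 1 ≤ d →
    (Z : Chain (suc d)) → IsSimpleCycle Z → Compatible (Supp Z) →
    VertexConnected (suc d) (facetGraph Z) ×
    ((R : List (CellOfRank (suc d))) (Q : List (CellOfRank d)) →
    length R + length Q ≤ d →
    Connected (deleteEdges (BothContainOneOf Q) (deleteVertices R (facetGraph Z))))
theorem5p8 F P d _ Z Z-simple Z-compatible = vertexConnected , Deletion.connected
  where open CellComplex.SimpleCycle F P Z Z-simple Z-compatible
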